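{- Let $p$ be a prime number, let $R$ be a perfect (commutative, unital) $\mathbb{F}_p$-algebra, and let $n$ be an integer with $n\geq 2$ and $p\geq n$. Let $\alpha_n\colon \mathbb{Z}R/I^n \xrightarrow{\sim} W_n(R)=R^n$ be the canonical ring isomorphism. Let $x\in\mathbb{Z}R/I^n$, and write $\alpha_n(x)=(r_0,r_1,\dots,r_{n-1})$. Then, denoting also by $x\in\mathbb{Z}R$ any representative of the class $x$, the components are recursively given by $$r_0=\pi(x),\qquad r_\nu=\pi\bigl(\delta(\cdots\delta(\delta(x-[r_0])-[r_1])\cdots-[r_{\nu-1}])\bigr)\quad\text{for }\nu=1,\dots,n-1.$$ Explicitly: setting $y_0=x\in\mathbb{Z}R$ and $y_\nu=\delta(y_{\nu-1}-[r_{\nu-1}])\in\mathbb{Z}R$ for $1\le\nu\le n-1$, one has $r_\nu=\pi(y_\nu)$ for all $0\le\nu\le n-1$.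
   Context: Let $p$ be a prime and $R$ a perfect $\mathbb{F}_p$-algebra, i.e. a commutative unital $\mathbb{F}_p$-algebra whose Frobenius $\phi\colon R\to R$, $r\mapsto r^p$, is bijective. $\mathbb{Z}R$ denotes the monoid algebra over $\mathbb{Z}$ of the multiplicative monoid $(R,\cdot)$: it is the free abelian group on symbols $[r]$, $r\in R$, with multiplication determined by $[r][s]=[rs]$ and unit $[1]=1$. Let $\pi\colon\mathbb{Z}R\to R$, $\sum n_r[r]\mapsto\sum n_r r$, be the natural ring projection and $I=\ker\pi$. Let $\phi\colon\mathbb{Z}R\to\mathbb{Z}R$ also denote the ring endomorphism $\sum n_r[r]\mapsto\sum n_r[r^p]$. One has $\phi(x)\equiv x^p \bmod p\mathbb{Z}R$ for $x\in\mathbb{Z}R$, and $\mathbb{Z}R$ is torsion-free, so there is a well-defined map (the "arithmetic derivation") $\delta\colon\mathbb{Z}R\to\mathbb{Z}R$, $\delta(x)=\frac1p(\phi(x)-x^p)$. $W_n(R)$ is the ring of $p$-typical Witt vectors of length $n$ over $R$, whose underlying set is $R^n$ (with components indexed $0,\dots,n-1$). The canonical ring isomorphism $\alpha_n\colon\mathbb{Z}R/I^n\to W_n(R)$ is the inverse of the (known) ring isomorphism $\beta_n\colon W_n(R)\to\mathbb{Z}R/I^n$ given by $$\beta_n(r_0,r_1,\dots,r_{n-1})=\sum_{k=0}^{n-1}p^k[\phi^{ -k}(r_k)]\bmod I^n,$$ where $\phi^{ -k}$ is the $k$-th iterate of the inverse of the Frobenius automorphism of $R$. -}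

module Defs where

open import Algebra.Bundles using (AbelianGroup; CommutativeMonoid; CommutativeRing)
open import Data.Fin.Base using (Fin; zero; suc; toℕ; fromℕ<; inject₁; fromℕ)
open import Data.Fin.Properties using (toℕ-inject₁; toℕ-fromℕ; toℕ<n)
open import Data.Nat.Base as ℕ using (ℕ; zero; suc; NonZero)
open import Data.Nat.Combinatorics using (_C_; nCn≡1; nC1≡n; k>n⇒nCk≡0; nCk+nC[k+1]≡[n+1]C[k+1])
open import Data.Nat.Divisibility using (_∣_; divides; ∣⇒≤)
open import Data.Nat.GeneralisedArithmetic using (iterate)
open import Data.Nat.Primality using (Prime; euclidsLemma; prime⇒nonZero)
import Data.Nat.Properties as ℕ
open import Data.Nat.Solver using (module +-*-Solver)
open import Data.Product.Base using (∃; _,_; proj₁; proj₂)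
open import Data.Sum.Base using (inj₁; inj₂)
open import Data.Vec.Functional using (Vector)
open import Data.Unit.Polymorphic.Base using (⊤)
open import Function.Definitions using (Bijective)
open import Level using (Level; _⊔_)
open import Relation.Binary.PropositionalEquality as ≡ using (_≡_)
open import Relation.Nullary using (contradiction)
open import Relation.Unary using (Pred)

private
  variable
    c ℓ c′ ℓ′ : Level

-- The monoid algebra ℤM: the free abelian group on the setoid underlying M,
-- presented by generators and relations, with the bilinear extension of the
-- product of M.
module MonoidAlgebra (M : CommutativeMonoid c ℓ) where

  private module M = CommutativeMonoid M

  infix  4 _≈_
  infixl 6 _+_
  infixl 7 _*_
  infix  8 -_

  data ℤM : Set c where
    [_] : M.Carrier → ℤM
    0#  : ℤM
    _+_ : ℤM → ℤM → ℤM
    -_  : ℤM → ℤM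

  data _≈_ : ℤM → ℤM → Set (c ⊔ ℓ) where
    refl         : ∀ {x} → x ≈ x
    sym          : ∀ {x y} → x ≈ y → y ≈ x
    trans        : ∀ {x y z} → x ≈ y → y ≈ z → x ≈ z
    []-cong      : ∀ {m n} → m M.≈ n → [ m ] ≈ [ n ]
    +-cong       : ∀ {x x′ y y′} → x ≈ x′ → y ≈ y′ → x + y ≈ x′ + y′
    -‿cong       : ∀ {x x′} → x ≈ x′ → - x ≈ - x′
    +-assoc      : ∀ x y z → (x + y) + z ≈ x + (y + z)
    +-comm       : ∀ x y → x + y ≈ y + x
    +-identityˡ  : ∀ x → 0# + x ≈ x
    -‿inverseˡ   : ∀ x → - x + x ≈ 0#

  _*_ : ℤM → ℤM → ℤM
  [ m ]   * [ n ]   = [ m M.∙ n ]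
  [ m ]   * 0#      = 0#
  [ m ]   * (y + z) = [ m ] * y + [ m ] * z
  [ m ]   * (- y)   = - ([ m ] * y)
  0#      * y       = 0#
  (x + z) * y       = x * y + z * y
  (- x)   * y       = - (x * y)

  1# : ℤM
  1# = [ M.ε ]

  +-abelianGroup : AbelianGroup c (c ⊔ ℓ)
  +-abelianGroup = record
    { Carrier = ℤM ; _≈_ = _≈_ ; _∙_ = _+_ ; ε = 0# ; _⁻¹ = -_
    ; isAbelianGroup = record
      { isGroup = record
        { isMonoid = record
          { isSemigroup = record
            { isMagma = record
              { isEquivalence = record { refl = refl ; sym = sym ; trans = trans }
              ; ∙-cong = +-cong
              }
            ; assoc = +-assoc
            }
          ; identity = +-identityˡ , λ x → trans (+-comm x 0#) (+-identityˡ x)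
          }
        ; inverse = -‿inverseˡ , λ x → trans (+-comm x (- x)) (-‿inverseˡ x)
        ; ⁻¹-cong = -‿cong
        }
      ; comm = +-comm
      }
    }

  private
    module G where
      open AbelianGroup +-abelianGroup public
      open import Algebra.Properties.AbelianGroup +-abelianGroup public
      open import Algebra.Properties.CommutativeSemigroup commutativeSemigroup public

    *-distribˡ : ∀ x y z → x * (y + z) ≈ x * y + x * z
    *-distribˡ [ m ]    y z = refl
    *-distribˡ 0#       y z = sym (+-identityˡ 0#)
    *-distribˡ (x + x′) y z = trans (+-cong (*-distribˡ x y z) (*-distribˡ x′ y z))
                                    (G.interchange _ _ _ _)
    *-distribˡ (- x)    y z = trans (-‿cong (*-distribˡ x y z)) (sym (G.⁻¹-∙-comm _ _))

    *-zeroʳ : ∀ x → x * 0# ≈ 0#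
    *-zeroʳ [ m ]    = refl
    *-zeroʳ 0#       = refl
    *-zeroʳ (x + x′) = trans (+-cong (*-zeroʳ x) (*-zeroʳ x′)) (+-identityˡ 0#)
    *-zeroʳ (- x)    = trans (-‿cong (*-zeroʳ x)) G.ε⁻¹≈ε

    *-negʳ : ∀ x y → x * (- y) ≈ - (x * y)
    *-negʳ [ m ]    y = refl
    *-negʳ 0#       y = sym G.ε⁻¹≈ε
    *-negʳ (x + x′) y = trans (+-cong (*-negʳ x y) (*-negʳ x′ y)) (G.⁻¹-∙-comm _ _)
    *-negʳ (- x)    y = -‿cong (*-negʳ x y)

    *-comm : ∀ x y → x * y ≈ y * x
    *-comm [ m ]    [ n ]    = []-cong (M.comm m n)
    *-comm [ m ]    0#       = refl
    *-comm [ m ]    (y + y′) = +-cong (*-comm [ m ] y) (*-comm [ m ] y′)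
    *-comm [ m ]    (- y)    = -‿cong (*-comm [ m ] y)
    *-comm 0#       y        = sym (*-zeroʳ y)
    *-comm (x + x′) y        = trans (+-cong (*-comm x y) (*-comm x′ y)) (sym (*-distribˡ y x x′))
    *-comm (- x)    y        = trans (-‿cong (*-comm x y)) (sym (*-negʳ y x))

    *-congʳ : ∀ {x x′} y → x ≈ x′ → x * y ≈ x′ * y
    *-congʳ y        refl             = refl
    *-congʳ y        (sym e)          = sym (*-congʳ y e)
    *-congʳ y        (trans e f)      = trans (*-congʳ y e) (*-congʳ y f)
    *-congʳ [ k ]    ([]-cong e)      = []-cong (M.∙-congʳ e)
    *-congʳ 0#       ([]-cong e)      = refl
    *-congʳ (y + y′) ([]-cong e)      = +-cong (*-congʳ y ([]-cong e)) (*-congʳ y′ ([]-cong e))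
    *-congʳ (- y)    ([]-cong e)      = -‿cong (*-congʳ y ([]-cong e))
    *-congʳ y        (+-cong e f)     = +-cong (*-congʳ y e) (*-congʳ y f)
    *-congʳ y        (-‿cong e)       = -‿cong (*-congʳ y e)
    *-congʳ y        (+-assoc _ _ _)  = +-assoc _ _ _
    *-congʳ y        (+-comm _ _)     = +-comm _ _
    *-congʳ y        (+-identityˡ _)  = +-identityˡ _
    *-congʳ y        (-‿inverseˡ _)   = -‿inverseˡ _

    *-cong : ∀ {x x′ y y′} → x ≈ x′ → y ≈ y′ → x * y ≈ x′ * y′
    *-cong {x} {x′} {y} {y′} e f =
      trans (*-congʳ y e) (trans (*-comm x′ y) (trans (*-congʳ x′ f) (*-comm y′ x′)))

    *-assoc : ∀ x y z → (x * y) * z ≈ x * (y * z)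
    *-assoc [ m ]    [ n ]    [ k ]    = []-cong (M.assoc m n k)
    *-assoc [ m ]    [ n ]    0#       = refl
    *-assoc [ m ]    [ n ]    (z + z′) = +-cong (*-assoc [ m ] [ n ] z) (*-assoc [ m ] [ n ] z′)
    *-assoc [ m ]    [ n ]    (- z)    = -‿cong (*-assoc [ m ] [ n ] z)
    *-assoc [ m ]    0#       z        = refl
    *-assoc [ m ]    (y + y′) z        = +-cong (*-assoc [ m ] y z) (*-assoc [ m ] y′ z)
    *-assoc [ m ]    (- y)    z        = -‿cong (*-assoc [ m ] y z)
    *-assoc 0#       y        z        = refl
    *-assoc (x + x′) y        z        = +-cong (*-assoc x y z) (*-assoc x′ y z)
    *-assoc (- x)    y        z        = -‿cong (*-assoc x y z)

    *-identityˡ : ∀ x → 1# * x ≈ x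
    *-identityˡ [ m ]    = []-cong (M.identityˡ m)
    *-identityˡ 0#       = refl
    *-identityˡ (x + x′) = +-cong (*-identityˡ x) (*-identityˡ x′)
    *-identityˡ (- x)    = -‿cong (*-identityˡ x)

  commutativeRing : CommutativeRing c (c ⊔ ℓ)
  commutativeRing = record
    { Carrier = ℤM ; _≈_ = _≈_ ; _+_ = _+_ ; _*_ = _*_ ; -_ = -_ ; 0# = 0# ; 1# = 1#
    ; isCommutativeRing = record
      { isRing = record
        { +-isAbelianGroup = AbelianGroup.isAbelianGroup +-abelianGroup
        ; *-cong     = *-cong
        ; *-assoc    = *-assoc
        ; *-identity = *-identityˡ , λ x → trans (*-comm x 1#) (*-identityˡ x)
        ; distrib    = *-distribˡ , λ x y z → refl
        }
      ; *-comm = *-comm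
      }
    }

  -- The additive extension of a map on generators.
  lift : (A : AbelianGroup c′ ℓ′) → (M.Carrier → AbelianGroup.Carrier A) →
         ℤM → AbelianGroup.Carrier A
  lift A f [ m ]   = f m
  lift A f 0#      = AbelianGroup.ε A
  lift A f (x + y) = AbelianGroup._∙_ A (lift A f x) (lift A f y)
  lift A f (- x)   = AbelianGroup._⁻¹ A (lift A f x)

module IdealPowers (A : CommutativeRing c ℓ) where

  open CommutativeRing A

  -- For ideals J and K this is their product: the finite sums of products jk.
  data _·_ {j k} (J : Pred Carrier j) (K : Pred Carrier k) : Pred Carrier (c ⊔ ℓ ⊔ j ⊔ k) where
    0∈   : (J · K) 0#
    +∈   : ∀ {x y} → (J · K) x → (J · K) y → (J · K) (x + y)
    *∈   : ∀ {x y} → J x → K y → (J · K) (x * y)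
    resp : ∀ {x y} → x ≈ y → (J · K) x → (J · K) y

  power : ∀ {i} → Pred Carrier i → ℕ → Pred Carrier (c ⊔ ℓ ⊔ i)
  power I zero    = λ _ → ⊤
  power I (suc n) = I · power I n

module _ (p : ℕ) (R : CommutativeRing c ℓ) where

  open CommutativeRing R
  open import Algebra.Properties.Semiring.Mult semiring using (_×_)
  open import Algebra.Properties.Semiring.Exp semiring using (_^_)

  record IsPerfectFpAlgebra : Set (c ⊔ ℓ) where
    field
      p×1≈0               : p × 1# ≈ 0#
      frobenius-bijective : Bijective _≈_ _≈_ (_^ p)

    frobenius⁻¹ : Carrier → Carrier
    frobenius⁻¹ r = proj₁ (proj₂ frobenius-bijective r)

module BinomialPrime {p : ℕ} (p-prime : Prime p) where

  absorption : ∀ n k → suc k ℕ.* (suc n C suc k) ≡ suc n ℕ.* (n C k)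
  absorption zero    zero    = ≡.refl
  absorption zero    (suc k) = ≡.trans
    (≡.cong (suc (suc k) ℕ.*_) (k>n⇒nCk≡0 {1} {suc (suc k)} (ℕ.s≤s (ℕ.s≤s ℕ.z≤n))))
    (ℕ.*-zeroʳ (suc (suc k)))
  absorption (suc n) zero    = ≡.trans (ℕ.*-identityˡ _)
    (≡.trans (nC1≡n (suc (suc n))) (≡.sym (ℕ.*-identityʳ _)))
  absorption (suc n) (suc k) = begin
    suc (suc k) ℕ.* (suc (suc n) C suc (suc k))
      ≡⟨ ≡.cong (suc (suc k) ℕ.*_) (nCk+nC[k+1]≡[n+1]C[k+1] (suc n) (suc k)) ⟨
    suc (suc k) ℕ.* (b ℕ.+ d)
      ≡⟨ solve 3 (λ k b d → (con 1 :+ k) :* (b :+ d) := b :+ (k :* b :+ (con 1 :+ k) :* d))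
               ≡.refl (suc k) b d ⟩
    b ℕ.+ (suc k ℕ.* b ℕ.+ suc (suc k) ℕ.* d)
      ≡⟨ ≡.cong (b ℕ.+_) (≡.cong₂ ℕ._+_ (absorption n k) (absorption n (suc k))) ⟩
    b ℕ.+ (suc n ℕ.* (n C k) ℕ.+ suc n ℕ.* (n C suc k))
      ≡⟨ ≡.cong (b ℕ.+_) (ℕ.*-distribˡ-+ (suc n) (n C k) (n C suc k)) ⟨
    b ℕ.+ suc n ℕ.* (n C k ℕ.+ n C suc k)
      ≡⟨ ≡.cong (λ e → b ℕ.+ suc n ℕ.* e) (nCk+nC[k+1]≡[n+1]C[k+1] n k) ⟩
    suc (suc n) ℕ.* b ∎
    where
    open ≡.≡-Reasoning
    open +-*-Solver
    b = suc n C suc k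
    d = suc n C suc (suc k)

  p∣pCk : ∀ k → suc k ℕ.< p → p ∣ (p C suc k)
  p∣pCk k k<p = go p ≡.refl
    where
    go : ∀ q → q ≡ p → p ∣ (p C suc k)
    go zero    ≡.refl = contradiction k<p λ ()
    go (suc n) ≡.refl with euclidsLemma (suc k) (suc n C suc k) p-prime
                             (divides (n C k) (≡.trans (absorption n k) (ℕ.*-comm (suc n) (n C k))))
    ... | inj₁ p∣k = contradiction (∣⇒≤ p∣k) (ℕ.<⇒≱ k<p)
    ... | inj₂ p∣C = p∣C

  module _ (A : CommutativeRing c ℓ) where

    open CommutativeRing A hiding (zero)
    open import Algebra.Properties.Semiring.Mult semiring
    open import Algebra.Properties.Semiring.Exp semiring
    open import Algebra.Properties.Semiring.Sum semiring
    open import Algebra.Properties.CommutativeMonoid.Mult +-commutativeMonoid using (×-distrib-+)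
    open import Algebra.Properties.CommutativeSemiring.Binomial commutativeSemiring
      using (binomialTerm; theorem)
    open import Relation.Binary.Reasoning.Setoid setoid

    p∣sum : ∀ {m} (t : Vector Carrier m) → (∀ i → ∃ λ d → t i ≈ p × d) → ∃ λ d → sum t ≈ p × d
    p∣sum {zero}  t h = 0# , sym (go p)
      where
      go : ∀ q → q × 0# ≈ 0#
      go zero    = refl
      go (suc q) = trans (+-identityˡ _) (go q)
    p∣sum {suc m} t h =
      let d , e = h zero
          d′ , e′ = p∣sum (λ i → t (suc i)) (λ i → h (suc i))
      in d + d′ , trans (+-cong e e′) (sym (×-distrib-+ d d′ p))

    freshman : ∀ x y → ∃ λ d → (x + y) ^ p ≈ (x ^ p + y ^ p) + p × d
    freshman x y = go p ≡.refl
      where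
      go : ∀ q → q ≡ p → ∃ λ d → (x + y) ^ p ≈ (x ^ p + y ^ p) + p × d
      go zero    ≡.refl = contradiction (prime⇒nonZero p-prime) λ ()
      go (suc n) ≡.refl = proj₁ middle , (begin
        (x + y) ^ p                                ≈⟨ theorem p x y ⟩
        t zero + sum (λ i → t (suc i))             ≈⟨ +-cong first (sum-init-last (λ i → t (suc i))) ⟩
        y ^ p + (sum (λ i → t (suc (inject₁ i))) + t (suc (fromℕ n)))
                                                   ≈⟨ +-congˡ (+-cong (proj₂ middle) last) ⟩
        y ^ p + (p × proj₁ middle + x ^ p)         ≈⟨ +-congˡ (+-comm _ _) ⟩
        y ^ p + (x ^ p + p × proj₁ middle)         ≈⟨ +-assoc _ _ _ ⟨
        (y ^ p + x ^ p) + p × proj₁ middle         ≈⟨ +-congʳ (+-comm _ _) ⟩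
        (x ^ p + y ^ p) + p × proj₁ middle         ∎)
        where
        t = binomialTerm x y p
        first : t zero ≈ y ^ p
        first = trans (+-identityʳ _) (*-identityˡ _)
        last : t (suc (fromℕ n)) ≈ x ^ p
        last rewrite toℕ-fromℕ n | nCn≡1 (suc n) | ℕ.n∸n≡0 n = trans (+-identityʳ _) (*-identityʳ _)
        term : ∀ (i : Fin n) → ∃ λ d → t (suc (inject₁ i)) ≈ p × d
        term i with p∣pCk (toℕ (inject₁ i))
                          (ℕ.s≤s (≡.subst (ℕ._< n) (≡.sym (toℕ-inject₁ i)) (toℕ<n i)))
        ... | divides k eq rewrite eq | ℕ.*-comm k p = _ , sym (×-assocˡ _ p k)
        middle : ∃ λ d → sum (λ i → t (suc (inject₁ i))) ≈ p × d
        middle = p∣sum _ term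

module Perfect (p : ℕ) (p-prime : Prime p)
               (R : CommutativeRing c ℓ) (perfect : IsPerfectFpAlgebra p R) where

  private
    module R where
      open CommutativeRing R public
      open import Algebra.Properties.Semiring.Exp semiring public using (_^_)

  open IsPerfectFpAlgebra perfect public

  open MonoidAlgebra R.*-commutativeMonoid public
    using ([_]; []-cong; lift) renaming (ℤM to ℤR; commutativeRing to ℤR-commutativeRing)

  open CommutativeRing ℤR-commutativeRing hiding (zero)
  open import Algebra.Properties.Semiring.Mult semiring using (_×_; ×-congʳ)
  open import Algebra.Properties.Semiring.Exp semiring using (_^_)
  open import Algebra.Properties.Semiring.Sum semiring using (sum-syntax)
  open IdealPowers ℤR-commutativeRing using (power)

  π : ℤR → R.Carrier
  π = lift R.+-abelianGroup (λ r → r)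

  φ : ℤR → ℤR
  φ = lift +-abelianGroup (λ r → [ r R.^ p ])

  I : Pred ℤR ℓ
  I x = π x R.≈ R.0#

  infix 4 _≡_mod-I^_
  _≡_mod-I^_ : ℤR → ℤR → ℕ → Set (c ⊔ ℓ)
  x ≡ y mod-I^ n = power I n (x - y)

  frobenius-lift : ∀ x → ∃ λ d → p × d ≈ φ x - x ^ p
  frobenius-lift = go
    where
    open import Algebra.Properties.AbelianGroup +-abelianGroup
      using (⁻¹-∙-comm; ⁻¹-involutive; inverseˡ-unique)
    open import Algebra.Properties.CommutativeMonoid.Mult +-commutativeMonoid using (×-distrib-+)
    open import Algebra.Properties.CommutativeSemigroup
      (CommutativeMonoid.commutativeSemigroup +-commutativeMonoid) using (interchange)
    open import Relation.Binary.Reasoning.Setoid setoid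
    open BinomialPrime p-prime using (freshman)

    []-homo-^ : ∀ r n → [ r ] ^ n ≈ [ r R.^ n ]
    []-homo-^ r zero    = refl
    []-homo-^ r (suc n) = *-congˡ ([]-homo-^ r n)

    ×-zeroʳ : ∀ n → n × 0# ≈ 0#
    ×-zeroʳ zero    = refl
    ×-zeroʳ (suc n) = trans (+-identityˡ _) (×-zeroʳ n)

    ×-neg : ∀ n x → n × (- x) ≈ - (n × x)
    ×-neg n x = inverseˡ-unique _ _
      (trans (sym (×-distrib-+ (- x) x n)) (trans (×-congʳ n (-‿inverseˡ x)) (×-zeroʳ n)))

    0^p≈0 : 0# ^ p ≈ 0#
    0^p≈0 = h p {{prime⇒nonZero p-prime}}
      where
      h : ∀ n → .{{NonZero n}} → 0# ^ n ≈ 0#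
      h (suc n) = zeroˡ (0# ^ n)

    go : ∀ x → ∃ λ d → p × d ≈ φ x - x ^ p
    go [ r ] = 0# , (begin
      p × 0#                     ≈⟨ ×-zeroʳ p ⟩
      0#                         ≈⟨ -‿inverseʳ _ ⟨
      [ r R.^ p ] - [ r R.^ p ]  ≈⟨ +-congˡ (-‿cong ([]-homo-^ r p)) ⟨
      [ r R.^ p ] - [ r ] ^ p    ∎)
    go MonoidAlgebra.0# = 0# , (begin
      p × 0#       ≈⟨ ×-zeroʳ p ⟩
      0#           ≈⟨ -‿inverseʳ _ ⟨
      0# - 0#      ≈⟨ +-congˡ (-‿cong 0^p≈0) ⟨
      0# - 0# ^ p  ∎)
    go (x MonoidAlgebra.+ y) with go x | go y | freshman ℤR-commutativeRing x y
    ... | dx , ex | dy , ey | C , eC = (dx + dy) - C , (begin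
      p × ((dx + dy) - C)                              ≈⟨ ×-distrib-+ _ _ p ⟩
      p × (dx + dy) + p × (- C)                        ≈⟨ +-cong (×-distrib-+ dx dy p) (×-neg p C) ⟩
      (p × dx + p × dy) - p × C                        ≈⟨ +-congʳ (+-cong ex ey) ⟩
      ((φ x - x ^ p) + (φ y - y ^ p)) - p × C          ≈⟨ +-congʳ (interchange _ _ _ _) ⟩
      ((φ x + φ y) + (- (x ^ p) - y ^ p)) - p × C      ≈⟨ +-assoc _ _ _ ⟩
      (φ x + φ y) + ((- (x ^ p) - y ^ p) - p × C)      ≈⟨ +-congˡ (+-congʳ (⁻¹-∙-comm _ _)) ⟩
      (φ x + φ y) + (- (x ^ p + y ^ p) - p × C)        ≈⟨ +-congˡ (⁻¹-∙-comm _ _) ⟩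
      (φ x + φ y) - ((x ^ p + y ^ p) + p × C)          ≈⟨ +-congˡ (-‿cong eC) ⟨
      (φ x + φ y) - (x + y) ^ p                        ∎)
    go (MonoidAlgebra.- x) with go x | freshman ℤR-commutativeRing x (- x)
    ... | dx , ex | C , eC = C - dx , (begin
      p × (C - dx)                        ≈⟨ ×-distrib-+ _ _ p ⟩
      p × C + p × (- dx)                  ≈⟨ +-congˡ (×-neg p dx) ⟩
      p × C - p × dx                      ≈⟨ +-congˡ (-‿cong ex) ⟩
      p × C - (φ x - x ^ p)               ≈⟨ +-congˡ (⁻¹-∙-comm _ _) ⟨
      p × C + (- φ x - - (x ^ p))         ≈⟨ +-congˡ (+-congˡ (⁻¹-involutive _)) ⟩
      p × C + (- φ x + x ^ p)             ≈⟨ +-comm _ _ ⟩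
      (- φ x + x ^ p) + p × C             ≈⟨ +-assoc _ _ _ ⟩
      - φ x + (x ^ p + p × C)             ≈⟨ +-congˡ (inverseˡ-unique _ _ sum≈0) ⟩
      - φ x - (- x) ^ p                   ∎)
      where
      sum≈0 : (x ^ p + p × C) + (- x) ^ p ≈ 0#
      sum≈0 = begin
        (x ^ p + p × C) + (- x) ^ p  ≈⟨ +-assoc _ _ _ ⟩
        x ^ p + (p × C + (- x) ^ p)  ≈⟨ +-congˡ (+-comm _ _) ⟩
        x ^ p + ((- x) ^ p + p × C)  ≈⟨ +-assoc _ _ _ ⟨
        (x ^ p + (- x) ^ p) + p × C  ≈⟨ eC ⟨
        (x + - x) ^ p                ≈⟨ h p (-‿inverseʳ x) ⟩
        0# ^ p                       ≈⟨ 0^p≈0 ⟩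
        0#                           ∎
        where
        open import Algebra.Properties.Semiring.Exp semiring using (^-congˡ)
        h : ∀ n {u v} → u ≈ v → u ^ n ≈ v ^ n
        h n = ^-congˡ n

  -- δ x = (φ x - x ^ p) / p.  As ℤR is torsion-free, δ x is determined up to _≈_
  -- by δ-spec.
  δ : ℤR → ℤR
  δ x = proj₁ (frobenius-lift x)

  δ-spec : ∀ x → p × δ x ≈ φ x - x ^ p
  δ-spec x = proj₂ (frobenius-lift x)

  -- The underlying set of Wₙ(R).
  W : ℕ → Set c
  W n = Vector R.Carrier n

  β : ∀ n → W n → ℤR
  β n r = ∑[ k < n ] ((p ℕ.^ toℕ k) × [ iterate frobenius⁻¹ (r k) (toℕ k) ])

  -- The graph of αₙ, the inverse of βₙ : Wₙ(R) → ℤR/Iⁿ, with classes modulo Iⁿ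
  -- given by arbitrary representatives.
  infix 4 α[_]_↦_
  α[_]_↦_ : ∀ n → ℤR → W n → Set (c ⊔ ℓ)
  α[ n ] x ↦ r = x ≡ β n r mod-I^ n

  y : ∀ {n} → ℤR → W n → ∀ ν → ν ℕ.< n → ℤR
  y x r zero    _   = x
  y x r (suc ν) ν<n = δ (y x r ν (ℕ.<⇒≤ ν<n) - [ r (fromℕ< (ℕ.<⇒≤ ν<n)) ])

{-# OPTIONS --safe #-}

module Submission where

-- Write φ⁻¹β r for the preimage of β n r under φ, so that β (n + 1) r is
-- [r₀] + p · φ⁻¹β (tail r).  If x ≡ β (n + 1) r mod Iⁿ⁺¹ and z = x - [r₀], then
-- z ∈ I, so zᵖ ∈ Iⁿ⁺¹ because n + 1 ≤ p, and p · δ z = φ z - zᵖ ≡ p · β n (tail r)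
-- mod Iⁿ⁺¹.  Since p a ∈ Iⁿ⁺¹ implies a ∈ Iⁿ, δ z represents the class of tail r
-- modulo Iⁿ, and one inducts on n.
--
-- For the division by p: δ maps Iⁿ⁺¹ into Iⁿ, δ (p a) is φ a up to a multiple of
-- p a, and φ is an automorphism preserving I.

open import Defs
open import Algebra.Bundles using (AbelianGroup; CommutativeMonoid; CommutativeRing)
open import Data.Fin.Base using (Fin; zero; suc; toℕ; fromℕ<; inject₁; fromℕ)
open import Data.Fin.Properties using (toℕ-inject₁; toℕ-fromℕ; toℕ<n)
open import Data.List.Base using (List; []; _∷_; _++_; foldr; map) renaming ([_] to singleton)
open import Data.Nat.Base as ℕ using (ℕ; zero; suc; _≤_; _<_; z≤n; s≤s)
open import Data.Nat.Combinatorics using (nCn≡1)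
open import Data.Nat.Divisibility using (divides)
open import Data.Nat.GeneralisedArithmetic using (iterate)
open import Data.Nat.Primality using (Prime; prime⇒nonZero; prime⇒nonTrivial)
import Data.Nat.Properties as ℕ
open import Data.Product.Base using (∃; _,_; proj₁; proj₂) renaming (_×_ to _∧_)
open import Data.Sum.Base using (inj₁; inj₂)
open import Data.Unit.Polymorphic.Base using (tt)
open import Data.Vec.Functional using (Vector; tail)
open import Level using (Level)
open import Relation.Binary.PropositionalEquality as ≡ using (_≡_)
open import Relation.Nullary using (contradiction)
open import Relation.Unary using (Pred)

private
  variable
    c ℓ c′ ℓ′ i : Level

-- Integer multiples and quotients by an integer in commutative rings.

module RingIdentities (A : CommutativeRing c ℓ) where

  open CommutativeRing A hiding (zero)
  open import Algebra.Properties.AbelianGroup +-abelianGroup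
    using (⁻¹-∙-comm; inverseˡ-unique; \\-leftDividesʳ)
  open import Algebra.Properties.CommutativeMonoid.Mult +-commutativeMonoid using (×-distrib-+)
  open import Algebra.Properties.CommutativeSemigroup
    (CommutativeMonoid.commutativeSemigroup +-commutativeMonoid) using (interchange)
  open import Algebra.Properties.Ring ring using (x[y-z]≈xy-xz; [y-z]x≈yx-zx)
  open import Algebra.Properties.Semiring.Mult semiring
    using (_×_; ×-congʳ; ×-assoc-*; ×-comm-*)
  open import Algebra.Properties.Semiring.Exp semiring using (_^_)
  open import Algebra.Properties.Semiring.Sum semiring using (sum)
  open import Relation.Binary.Reasoning.Setoid setoid

  ×-zeroʳ : ∀ n → n × 0# ≈ 0#
  ×-zeroʳ zero    = refl
  ×-zeroʳ (suc n) = trans (+-identityˡ _) (×-zeroʳ n)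

  ×-neg : ∀ n x → n × (- x) ≈ - (n × x)
  ×-neg n x = inverseˡ-unique _ _
    (trans (sym (×-distrib-+ (- x) x n)) (trans (×-congʳ n (-‿inverseˡ x)) (×-zeroʳ n)))

  ×-distrib-sub : ∀ n x y → n × (x - y) ≈ n × x - n × y
  ×-distrib-sub n x y = trans (×-distrib-+ x (- y) n) (+-congˡ (×-neg n y))

  ^-zero : ∀ n → .{{ℕ.NonZero n}} → 0# ^ n ≈ 0#
  ^-zero (suc n) = zeroˡ _

  sub-sub : ∀ x y z → (x - y) - z ≈ x - (y + z)
  sub-sub x y z = trans (+-assoc _ _ _) (+-congˡ (⁻¹-∙-comm y z))

  ×-distrib-sum : ∀ n {m} (v : Vector Carrier m) → n × sum v ≈ sum (λ k → n × v k)
  ×-distrib-sum n {zero}  v = ×-zeroʳ n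
  ×-distrib-sum n {suc m} v = trans (×-distrib-+ _ _ n) (+-congˡ (×-distrib-sum n (tail v)))

  telescope : ∀ x y z → (x - y) + (y - z) ≈ x - z
  telescope x y z = trans (+-assoc _ _ _) (+-congˡ (\\-leftDividesʳ y (- z)))

  -- In the next two lemmas f stands for φ x, a for x ^ n and d for δ x.
  quotient-+ : ∀ n {d d′ f f′ a a′ c s} → n × d ≈ f - a → n × d′ ≈ f′ - a′ →
               s ≈ (a + a′) + n × c → n × ((d + d′) - c) ≈ (f + f′) - s
  quotient-+ n {d} {d′} {f} {f′} {a} {a′} {c} {s} e e′ e″ = begin
    n × ((d + d′) - c)                  ≈⟨ ×-distrib-sub n _ c ⟩
    n × (d + d′) - n × c                ≈⟨ +-congʳ (×-distrib-+ d d′ n) ⟩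
    (n × d + n × d′) - n × c            ≈⟨ +-congʳ (+-cong e e′) ⟩
    ((f - a) + (f′ - a′)) - n × c       ≈⟨ +-congʳ (interchange _ _ _ _) ⟩
    ((f + f′) + (- a - a′)) - n × c     ≈⟨ +-congʳ (+-congˡ (⁻¹-∙-comm a a′)) ⟩
    ((f + f′) - (a + a′)) - n × c       ≈⟨ sub-sub _ _ _ ⟩
    (f + f′) - ((a + a′) + n × c)       ≈⟨ +-congˡ (-‿cong e″) ⟨
    (f + f′) - s                        ∎

  quotient-* : ∀ n {d d′ f f′ a a′} → n × d ≈ f - a → n × d′ ≈ f′ - a′ →
               n × (d * f′ + a * d′) ≈ f * f′ - a * a′
  quotient-* n {d} {d′} {f} {f′} {a} {a′} e e′ = begin
    n × (d * f′ + a * d′)                   ≈⟨ ×-distrib-+ _ _ n ⟩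
    n × (d * f′) + n × (a * d′)             ≈⟨ +-cong (×-assoc-* n d f′) (×-comm-* n a d′) ⟨
    (n × d) * f′ + a * (n × d′)             ≈⟨ +-cong (*-congʳ e) (*-congˡ e′) ⟩
    (f - a) * f′ + a * (f′ - a′)            ≈⟨ +-cong ([y-z]x≈yx-zx f′ f a) (x[y-z]≈xy-xz a f′ a′) ⟩
    (f * f′ - a * f′) + (a * f′ - a * a′)   ≈⟨ telescope _ _ _ ⟩
    f * f′ - a * a′                         ∎

-- Additive extensions of maps on the generators of a monoid algebra.

module MonoidAlgebraProperties (M : CommutativeMonoid c ℓ) where

  private module M = CommutativeMonoid M

  open MonoidAlgebra M

  module _ (A : AbelianGroup c′ ℓ′) where

    private module A = AbelianGroup A

    lift-cong : {f : M.Carrier → A.Carrier} → (∀ {m n} → m M.≈ n → f m A.≈ f n) →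
                ∀ {x y} → x ≈ y → lift A f x A.≈ lift A f y
    lift-cong {f} f-cong = go
      where
      go : ∀ {x y} → x ≈ y → lift A f x A.≈ lift A f y
      go refl            = A.refl
      go (sym e)         = A.sym (go e)
      go (trans e e′)    = A.trans (go e) (go e′)
      go ([]-cong e)     = f-cong e
      go (+-cong e e′)   = A.∙-cong (go e) (go e′)
      go (-‿cong e)      = A.⁻¹-cong (go e)
      go (+-assoc _ _ _) = A.assoc _ _ _
      go (+-comm _ _)    = A.comm _ _
      go (+-identityˡ _) = A.identityˡ _
      go (-‿inverseˡ _)  = A.inverseˡ _

  module _ (B : CommutativeRing c′ ℓ′) where

    private module B = CommutativeRing B
    open import Algebra.Properties.Ring B.ring using (-‿distribˡ-*; -‿distribʳ-*)

    lift-*-homo : {f : M.Carrier → B.Carrier} → (∀ m n → f (m M.∙ n) B.≈ f m B.* f n) →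
                  let ⟦_⟧ = lift B.+-abelianGroup f in
                  ∀ x y → ⟦ x * y ⟧ B.≈ ⟦ x ⟧ B.* ⟦ y ⟧
    lift-*-homo {f} f-homo = go
      where
      ⟦_⟧ = lift B.+-abelianGroup f
      go : ∀ x y → ⟦ x * y ⟧ B.≈ ⟦ x ⟧ B.* ⟦ y ⟧
      go [ m ]    [ n ]   = f-homo m n
      go [ m ]    0#      = B.sym (B.zeroʳ _)
      go [ m ]    (y + z) = B.trans (B.+-cong (go [ m ] y) (go [ m ] z)) (B.sym (B.distribˡ _ _ _))
      go [ m ]    (- y)   = B.trans (B.-‿cong (go [ m ] y)) (-‿distribʳ-* _ _)
      go 0#       y       = B.sym (B.zeroˡ _)
      go (x + x′) y       = B.trans (B.+-cong (go x y) (go x′ y)) (B.sym (B.distribʳ _ _ _))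
      go (- x)    y       = B.trans (B.-‿cong (go x y)) (-‿distribˡ-* _ _)

  lift-inverse : {f g : M.Carrier → M.Carrier} → (∀ m → f (g m) M.≈ m) →
                 ∀ x → lift +-abelianGroup (λ m → [ f m ]) (lift +-abelianGroup (λ m → [ g m ]) x) ≈ x
  lift-inverse fg [ m ]   = []-cong (fg m)
  lift-inverse fg 0#      = refl
  lift-inverse fg (x + y) = +-cong (lift-inverse fg x) (lift-inverse fg y)
  lift-inverse fg (- x)   = -‿cong (lift-inverse fg x)

  -- Torsion-freeness of the monoid algebra.

  private module A = CommutativeRing commutativeRing

  open import Algebra.Properties.Semiring.Mult A.semiring using (_×_)
  open import Algebra.Properties.Semiring.Sum A.semiring using (sum)
  open RingIdentities commutativeRing using (×-distrib-sub)
  open import Data.List.Relation.Binary.Permutation.Setoid M.setoid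
    using (_↭_; prep; ↭-refl; ↭-sym; ↭-trans; ↭-reflexive; ↭-reflexive-≋)
  open import Data.List.Relation.Binary.Permutation.Setoid.Properties M.setoid
    using (++-commutativeMonoid; ++⁺; ∈-resp-↭; ¬x∷xs↭[]; shift; dropMiddle; map⁺)
  open import Data.List.Membership.Setoid M.setoid using (_∈_)
  open import Data.List.Membership.Setoid.Properties using (∈-∃++; ∈-++⁻)
  open import Data.List.Relation.Unary.Any using (here)

  open import Algebra.Solver.CommutativeMonoid ++-commutativeMonoid using (solve; _⊕_; _⊜_; id)
  open import Algebra.Properties.Monoid.Mult (CommutativeMonoid.monoid ++-commutativeMonoid)
    using () renaming (_×_ to _copies_; ×-congʳ to copies-cong)
  open import Algebra.Properties.CommutativeMonoid.Mult ++-commutativeMonoid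
    using () renaming (×-distrib-+ to copies-++)

  -- Equality in M need not be decidable, so torsion-freeness of ℤM cannot be read
  -- off from coefficients; instead an element is presented by two lists of
  -- generators, and n-fold copies are cancelled from a permutation.
  copies-∈⁻ : ∀ n {m xs} → m ∈ (n copies xs) → m ∈ xs
  copies-∈⁻ (suc n) {xs = xs} m∈ with ∈-++⁻ M.setoid xs m∈
  ... | inj₁ h = h
  ... | inj₂ h = copies-∈⁻ n h

  -- Induction on `xs`: its head occurs in the copies of `ys`, hence in `ys` itself, and can be
  -- moved to the front there.
  copies-cancel : ∀ n xs ys → suc n copies xs ↭ suc n copies ys → xs ↭ ys
  copies-cancel n []       []       h = ↭-refl
  copies-cancel n []       (y ∷ ys) h = contradiction (↭-trans (↭-sym h) (copies-[] (suc n))) ¬x∷xs↭[]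
    where
    copies-[] : ∀ n → n copies [] ↭ []
    copies-[] zero    = ↭-refl
    copies-[] (suc n) = copies-[] n
  copies-cancel n (x ∷ xs) ys       h
    with as , bs , w , x≈w , ys≋ ← ∈-∃++ M.setoid (copies-∈⁻ (suc n) (∈-resp-↭ h (here M.refl))) =
    ↭-trans (prep M.refl (copies-cancel n xs (as ++ bs) h′)) (↭-sym ys↭)
    where
    ys↭ : ys ↭ x ∷ as ++ bs
    ys↭ = ↭-trans (↭-reflexive-≋ ys≋) (shift (M.sym x≈w) as bs)
    -- Taking copies distributes over `++`, so the copies of `x` stand in front on both sides and
    -- are dropped together.
    h′ : suc n copies xs ↭ suc n copies (as ++ bs)
    h′ = dropMiddle {vs = suc n copies singleton x} [] []
      (↭-trans (↭-sym (copies-++ (singleton x) xs (suc n)))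
      (↭-trans h
      (↭-trans (copies-cong (suc n) ys↭)
               (copies-++ (singleton x) (as ++ bs) (suc n)))))

  -- The generators occurring in an element with positive and with negative sign.
  pos neg : ℤM → List M.Carrier
  pos [ m ]   = singleton m
  pos 0#      = []
  pos (x + y) = pos x ++ pos y
  pos (- x)   = neg x
  neg [ m ]   = []
  neg 0#      = []
  neg (x + y) = neg x ++ neg y
  neg (- x)   = pos x

  -- Lists up to permutation form the free commutative monoid, and `x` is read as the formal
  -- difference of `pos x` and `neg x`; this is equality in the Grothendieck group with the negative
  -- parts moved across.
  ≈⇒↭ : ∀ {x y} → x ≈ y → pos x ++ neg y ↭ pos y ++ neg x
  ≈⇒↭ refl = ↭-refl
  ≈⇒↭ (sym e) = ↭-sym (≈⇒↭ e)
  -- Concatenating both permutations leaves `pos y` and `neg y` on either side, where they cancel.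
  ≈⇒↭ (trans {x} {y} {z} e e′) = dropMiddle {vs = pos y ++ neg y} [] []
    (↭-trans (solve 4 (λ a b c d → ((a ⊕ b) ⊕ (c ⊕ d)) ⊜ ((c ⊕ b) ⊕ (a ⊕ d))) ↭-refl
                    (pos y) (neg y) (pos x) (neg z))
    (↭-trans (++⁺ (≈⇒↭ e) (≈⇒↭ e′))
             (solve 4 (λ a b c d → ((a ⊕ b) ⊕ (c ⊕ d)) ⊜ ((a ⊕ d) ⊕ (c ⊕ b))) ↭-refl
                    (pos y) (neg x) (pos z) (neg y))))
  ≈⇒↭ ([]-cong e) = prep e ↭-refl
  ≈⇒↭ (+-cong {x} {x′} {y} {y′} e f) =
    ↭-trans (solve 4 interchange ↭-refl (pos x) (pos y) (neg x′) (neg y′))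
    (↭-trans (++⁺ (≈⇒↭ e) (≈⇒↭ f))
             (solve 4 interchange ↭-refl (pos x′) (neg x) (pos y′) (neg y)))
    where interchange = λ a b c d → ((a ⊕ b) ⊕ (c ⊕ d)) ⊜ ((a ⊕ c) ⊕ (b ⊕ d))
  ≈⇒↭ (-‿cong {x} {x′} e) =
    ↭-trans (solve 2 (λ a b → (a ⊕ b) ⊜ (b ⊕ a)) ↭-refl (neg x) (pos x′))
    (↭-trans (↭-sym (≈⇒↭ e))
             (solve 2 (λ a b → (a ⊕ b) ⊜ (b ⊕ a)) ↭-refl (pos x) (neg x′)))
  ≈⇒↭ (+-assoc x y z) =
    solve 6 (λ a b c a′ b′ c′ → (((a ⊕ b) ⊕ c) ⊕ (a′ ⊕ (b′ ⊕ c′))) ⊜ ((a ⊕ (b ⊕ c)) ⊕ ((a′ ⊕ b′) ⊕ c′)))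
          ↭-refl (pos x) (pos y) (pos z) (neg x) (neg y) (neg z)
  ≈⇒↭ (+-comm x y) =
    solve 4 (λ a b a′ b′ → ((a ⊕ b) ⊕ (b′ ⊕ a′)) ⊜ ((b ⊕ a) ⊕ (a′ ⊕ b′)))
          ↭-refl (pos x) (pos y) (neg x) (neg y)
  ≈⇒↭ (+-identityˡ x) = ↭-refl
  ≈⇒↭ (-‿inverseˡ x) =
    solve 2 (λ a b → ((b ⊕ a) ⊕ id) ⊜ (id ⊕ (a ⊕ b))) ↭-refl (pos x) (neg x)

  open import Data.List.Relation.Binary.Permutation.Setoid.Properties A.setoid
    using (foldr-commMonoid)
  open import Algebra.Properties.AbelianGroup A.+-abelianGroup
    using (⁻¹-∙-comm; ⁻¹-anti-homo‿-; x≈y⇒x∙y⁻¹≈ε; x∙y⁻¹≈ε⇒x≈y; ε⁻¹≈ε)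
  open import Algebra.Properties.CommutativeSemigroup
    (CommutativeMonoid.commutativeSemigroup A.+-commutativeMonoid) using (interchange)
  open import Relation.Binary.Reasoning.Setoid A.setoid

  listSum : List M.Carrier → ℤM
  listSum xs = foldr _+_ 0# (map [_] xs)

  listSum-cong : ∀ {xs ys} → xs ↭ ys → listSum xs ≈ listSum ys
  listSum-cong h = foldr-commMonoid A.+-isCommutativeMonoid (map⁺ A.setoid []-cong h)

  listSum-++ : ∀ xs ys → listSum (xs ++ ys) ≈ listSum xs + listSum ys
  listSum-++ []       ys = sym (+-identityˡ _)
  listSum-++ (x ∷ xs) ys = trans (A.+-congˡ (listSum-++ xs ys)) (sym (+-assoc _ _ _))

  -- This is the way back from permutations to equations: if `pos x` and `neg x` agree up to order,
  -- the two sums cancel.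
  pos-neg-decomposition : ∀ x → x ≈ listSum (pos x) A.- listSum (neg x)
  pos-neg-decomposition [ m ]   = begin
    [ m ]                ≈⟨ A.+-identityʳ _ ⟨
    [ m ] + 0#           ≈⟨ A.+-identityʳ _ ⟨
    [ m ] + 0# + 0#      ≈⟨ A.+-congˡ ε⁻¹≈ε ⟨
    [ m ] + 0# + - 0#    ∎
  pos-neg-decomposition 0#      = sym (A.-‿inverseʳ 0#)
  pos-neg-decomposition (x + y) = begin
    x + y
      ≈⟨ +-cong (pos-neg-decomposition x) (pos-neg-decomposition y) ⟩
    (listSum (pos x) A.- listSum (neg x)) + (listSum (pos y) A.- listSum (neg y))
      ≈⟨ interchange _ _ _ _ ⟩
    (listSum (pos x) + listSum (pos y)) + (- listSum (neg x) + - listSum (neg y))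
      ≈⟨ +-cong (sym (listSum-++ (pos x) (pos y)))
                (trans (⁻¹-∙-comm _ _) (-‿cong (sym (listSum-++ (neg x) (neg y))))) ⟩
    listSum (pos x ++ pos y) A.- listSum (neg x ++ neg y) ∎
  pos-neg-decomposition (- x)   = trans (-‿cong (pos-neg-decomposition x)) (⁻¹-anti-homo‿- _ _)

  pos-× : ∀ n x → pos (n × x) ≡ n copies pos x
  pos-× zero    x = ≡.refl
  pos-× (suc n) x = ≡.cong (pos x ++_) (pos-× n x)

  neg-× : ∀ n x → neg (n × x) ≡ n copies neg x
  neg-× zero    x = ≡.refl
  neg-× (suc n) x = ≡.cong (neg x ++_) (neg-× n x)

  -- The hypothesis makes the copies of `pos x` a permutation of those of `neg x`. Cancelling the
  -- copies makes `pos x` a permutation of `neg x`.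
  torsion-free : ∀ n → .{{ℕ.NonZero n}} → ∀ x → n × x ≈ 0# → x ≈ 0#
  torsion-free (suc n) x e =
    trans (pos-neg-decomposition x) (x≈y⇒x∙y⁻¹≈ε (listSum-cong (copies-cancel n (pos x) (neg x) balanced)))
    where
    balanced : suc n copies pos x ↭ suc n copies neg x
    balanced = ↭-trans (↭-reflexive (≡.sym (pos-× (suc n) x)))
      (↭-trans (solve 1 (λ a → a ⊜ (a ⊕ id)) ↭-refl (pos (suc n × x)))
      (↭-trans (≈⇒↭ e) (↭-reflexive (neg-× (suc n) x))))

  ×-cancelˡ : ∀ n → .{{ℕ.NonZero n}} → ∀ {x y} → n × x ≈ n × y → x ≈ y
  ×-cancelˡ n {x} {y} e = x∙y⁻¹≈ε⇒x≈y x y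
    (torsion-free n (x A.- y) (trans (×-distrib-sub n x y) (x≈y⇒x∙y⁻¹≈ε e)))

  -- Additive extensions on multiples and finite sums.

  module _ (A : AbelianGroup c′ ℓ′) {f : M.Carrier → AbelianGroup.Carrier A} where

    open import Algebra.Properties.Monoid.Mult (AbelianGroup.monoid A) using () renaming (_×_ to _×ᴬ_)
    open import Algebra.Properties.Monoid.Sum (AbelianGroup.monoid A) using () renaming (sum to sumᴬ)

    lift-× : ∀ n x → lift A f (n × x) ≡ n ×ᴬ lift A f x
    lift-× zero    x = ≡.refl
    lift-× (suc n) x = ≡.cong (AbelianGroup._∙_ A (lift A f x)) (lift-× n x)

    lift-sum : ∀ {n} (v : Vector ℤM n) → lift A f (sum v) ≡ sumᴬ (λ k → lift A f (v k))
    lift-sum {zero}  v = ≡.refl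
    lift-sum {suc n} v = ≡.cong (AbelianGroup._∙_ A (lift A f (v zero))) (lift-sum (tail v))

-- The binomial expansion of a `p`-th power.

module _ {p : ℕ} (p-prime : Prime p) (A : CommutativeRing c ℓ) where

  open CommutativeRing A hiding (zero)
  open import Algebra.Properties.Semiring.Mult semiring using (_×_; ×-congʳ; ×-comm-*; ×-assocˡ; ×-assoc-*)
  open import Algebra.Properties.Semiring.Exp semiring using (_^_)
  open import Algebra.Properties.Semiring.Sum semiring
  open import Algebra.Properties.CommutativeSemiring.Binomial commutativeSemiring
    using (binomialTerm; theorem)
  open import Relation.Binary.Reasoning.Setoid setoid
  open BinomialPrime p-prime using (p∣pCk)

  -- BinomialPrime.freshman does not record that the quotient lies in the ideal of x.
  freshman-ideal : ∀ x y → ∃ λ e → (x + y) ^ p ≈ (x ^ p + y ^ p) + p × (x * e)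
  freshman-ideal x y = go p ≡.refl
    where
    go : ∀ q → q ≡ p → ∃ λ e → (x + y) ^ p ≈ (x ^ p + y ^ p) + p × (x * e)
    go zero    ≡.refl = contradiction (prime⇒nonZero p-prime) λ ()
    go (suc n) ≡.refl = sum quotient , (begin
      (x + y) ^ p                                ≈⟨ theorem p x y ⟩
      t zero + sum (λ i → t (suc i))             ≈⟨ +-cong first (sum-init-last (λ i → t (suc i))) ⟩
      y ^ p + (sum (λ i → t (suc (inject₁ i))) + t (suc (fromℕ n)))
                                                 ≈⟨ +-congˡ (+-cong middle last) ⟩
      y ^ p + (p × (x * sum quotient) + x ^ p)   ≈⟨ +-congˡ (+-comm _ _) ⟩
      y ^ p + (x ^ p + p × (x * sum quotient))   ≈⟨ +-assoc _ _ _ ⟨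
      (y ^ p + x ^ p) + p × (x * sum quotient)   ≈⟨ +-congʳ (+-comm _ _) ⟩
      (x ^ p + y ^ p) + p × (x * sum quotient)   ∎)
      where
      t = binomialTerm x y p
      first : t zero ≈ y ^ p
      first = trans (+-identityʳ _) (*-identityˡ _)
      last : t (suc (fromℕ n)) ≈ x ^ p
      last rewrite toℕ-fromℕ n | nCn≡1 (suc n) | ℕ.n∸n≡0 n = trans (+-identityʳ _) (*-identityʳ _)
      -- In an inner term the binomial coefficient supplies `p`, and the exponent of `x` is a
      -- successor, so one factor `x` splits off.
      term : ∀ (i : Fin n) → ∃ λ e → t (suc (inject₁ i)) ≈ (p × x) * e
      term i with p∣pCk (toℕ (inject₁ i))
                        (s≤s (≡.subst (_< n) (≡.sym (toℕ-inject₁ i)) (toℕ<n i)))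
      ... | divides k eq rewrite eq | ℕ.*-comm k p = k × (x ^ toℕ (inject₁ i) * y ^ (n ℕ.∸ toℕ (inject₁ i))) , (begin
        (p ℕ.* k) × ((x * u) * v)  ≈⟨ ×-assocˡ _ p k ⟨
        p × (k × ((x * u) * v))    ≈⟨ ×-congʳ p (×-congʳ k (*-assoc x u v)) ⟩
        p × (k × (x * (u * v)))    ≈⟨ ×-congʳ p (×-comm-* k x (u * v)) ⟨
        p × (x * (k × (u * v)))    ≈⟨ ×-assoc-* p x _ ⟨
        (p × x) * (k × (u * v))    ∎)
        where
        u = x ^ toℕ (inject₁ i)
        v = y ^ (n ℕ.∸ toℕ (inject₁ i))
      quotient : Vector Carrier n
      quotient i = proj₁ (term i)
      middle : sum (λ i → t (suc (inject₁ i))) ≈ p × (x * sum quotient)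
      middle = begin
        sum (λ i → t (suc (inject₁ i)))     ≈⟨ sum-cong-≋ (λ i → proj₂ (term i)) ⟩
        sum (λ i → (p × x) * quotient i)    ≈⟨ *-distribˡ-sum (p × x) quotient ⟨
        (p × x) * sum quotient              ≈⟨ ×-assoc-* p x _ ⟩
        p × (x * sum quotient)              ∎

-- Powers of an ideal.

module IdealPowersProperties (A : CommutativeRing c ℓ) where

  open CommutativeRing A hiding (zero)
  open import Algebra.Properties.Semiring.Exp semiring using (_^_)
  open import Algebra.Properties.Ring ring using (-1*x≈-x)
  open IdealPowers A

  module _ {I : Pred Carrier i} where

    power-0# : ∀ n → power I n 0#
    power-0# zero    = tt
    power-0# (suc n) = 0∈

    power-resp : ∀ n {x y} → x ≈ y → power I n x → power I n y
    power-resp zero    _ _ = tt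
    power-resp (suc n) e h = resp e h

    power-+ : ∀ n {x y} → power I n x → power I n y → power I n (x + y)
    power-+ zero    _ _ = tt
    power-+ (suc n) g h = +∈ g h

    -- Each product absorbs `a` in its right factor, and the recursion ends in `power I 0`, the
    -- whole ring. So the powers are ideals for an arbitrary predicate `I`.
    power-*ʳ : ∀ n {x} a → power I n x → power I n (x * a)
    power-*ʳ zero    a _           = tt
    power-*ʳ (suc n) a 0∈          = resp (sym (zeroˡ a)) 0∈
    power-*ʳ (suc n) a (+∈ g h)    = resp (sym (distribʳ a _ _)) (+∈ (power-*ʳ (suc n) a g) (power-*ʳ (suc n) a h))
    power-*ʳ (suc n) a (*∈ hx hy)  = resp (sym (*-assoc _ _ a)) (*∈ hx (power-*ʳ n a hy))
    power-*ʳ (suc n) a (resp e h)  = resp (*-congʳ e) (power-*ʳ (suc n) a h)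

    power-*ˡ : ∀ n {x} a → power I n x → power I n (a * x)
    power-*ˡ n a h = power-resp n (*-comm _ a) (power-*ʳ n a h)

    power-neg : ∀ n {x} → power I n x → power I n (- x)
    power-neg n h = power-resp n (-1*x≈-x _) (power-*ˡ n (- 1#) h)

    power-sub : ∀ n {x y} → power I n x → power I n y → power I n (x - y)
    power-sub n g h = power-+ n g (power-neg n h)

    power-pred : ∀ n {x} → power I (suc n) x → power I n x
    power-pred zero    _          = tt
    power-pred (suc n) 0∈         = 0∈
    power-pred (suc n) (+∈ g h)   = +∈ (power-pred (suc n) g) (power-pred (suc n) h)
    power-pred (suc n) (*∈ hx hy) = *∈ hx (power-pred n hy)
    power-pred (suc n) (resp e h) = resp e (power-pred (suc n) h)

    ^-power : ∀ {m n x} → m ≤ n → I x → power I m (x ^ n)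
    ^-power z≤n     hx = tt
    ^-power (s≤s h) hx = *∈ hx (^-power h hx)

    power-map : (f : Carrier → Carrier) → f 0# ≈ 0# →
                (∀ x y → f (x + y) ≈ f x + f y) → (∀ x y → f (x * y) ≈ f x * f y) →
                (∀ {x y} → x ≈ y → f x ≈ f y) → (∀ {x} → I x → I (f x)) →
                ∀ n {x} → power I n x → power I n (f x)
    power-map f f-0 f-+ f-* f-cong f-I = go
      where
      go : ∀ n {x} → power I n x → power I n (f x)
      go zero    _          = tt
      go (suc n) 0∈         = resp (sym f-0) 0∈
      go (suc n) (+∈ g h)   = resp (sym (f-+ _ _)) (+∈ (go (suc n) g) (go (suc n) h))
      go (suc n) (*∈ hx hy) = resp (sym (f-* _ _)) (*∈ (f-I hx) (go n hy))
      go (suc n) (resp e h) = resp (f-cong e) (go (suc n) h)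

-- The Frobenius automorphism of `ℤR` and the ideal `I`.

module PerfectProperties (p : ℕ) (p-prime : Prime p)
                         (R : CommutativeRing c ℓ) (perfect : IsPerfectFpAlgebra p R) where

  private
    module R where
      open CommutativeRing R public
      open import Algebra.Properties.AbelianGroup +-abelianGroup public using (x∙y⁻¹≈ε⇒x≈y)
      open import Algebra.Properties.CommutativeSemiring.Exp commutativeSemiring public
        using (_^_; ^-congˡ; ^-distrib-*)
      open import Algebra.Properties.Semiring.Mult semiring public using (_×_; ×-congʳ; ×-assoc-*)
      open RingIdentities R public using (^-zero)

    instance
      p-nonZero : ℕ.NonZero p
      p-nonZero = prime⇒nonZero p-prime

  open Perfect p p-prime R perfect
  open MonoidAlgebraProperties R.*-commutativeMonoid
  open CommutativeRing ℤR-commutativeRing hiding (zero)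
  open import Algebra.Properties.CommutativeSemiring.Exp commutativeSemiring
    using (_^_; ^-congˡ; ^-congʳ; ^-distrib-*)
  open import Algebra.Properties.Semiring.Mult semiring
    using (_×_; ×-congʳ; ×-assocˡ; ×-assoc-*; ×-homo-1)
  open import Algebra.Properties.Semiring.Sum semiring using (sum; sum-cong-≋; sum-syntax)
  open import Algebra.Properties.AbelianGroup +-abelianGroup using (//-rightDividesˡ)
  open import Algebra.Properties.CommutativeSemigroup
    (CommutativeMonoid.commutativeSemigroup +-commutativeMonoid) using (xy∙z≈xz∙y)
  open IdealPowers ℤR-commutativeRing
  open IdealPowersProperties ℤR-commutativeRing
  open RingIdentities ℤR-commutativeRing

  frobenius-injective : ∀ {r s} → r R.^ p R.≈ s R.^ p → r R.≈ s
  frobenius-injective = proj₁ frobenius-bijective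

  frobenius-frobenius⁻¹ : ∀ r → frobenius⁻¹ r R.^ p R.≈ r
  frobenius-frobenius⁻¹ r = proj₂ (proj₂ frobenius-bijective r) R.refl

  -- Surjectivity only picks preimages; that the choice respects equality, and likewise products,
  -- follows from injectivity.
  frobenius⁻¹-cong : ∀ {r s} → r R.≈ s → frobenius⁻¹ r R.≈ frobenius⁻¹ s
  frobenius⁻¹-cong e = frobenius-injective
    (R.trans (frobenius-frobenius⁻¹ _) (R.trans e (R.sym (frobenius-frobenius⁻¹ _))))

  frobenius⁻¹-homo : ∀ r s → frobenius⁻¹ (r R.* s) R.≈ frobenius⁻¹ r R.* frobenius⁻¹ s
  frobenius⁻¹-homo r s = frobenius-injective (R.trans (frobenius-frobenius⁻¹ _) (R.sym
    (R.trans (R.^-distrib-* _ _ p) (R.*-cong (frobenius-frobenius⁻¹ r) (frobenius-frobenius⁻¹ s)))))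

  φ⁻¹ : ℤR → ℤR
  φ⁻¹ = lift +-abelianGroup (λ r → [ frobenius⁻¹ r ])

  φ-cong : ∀ {x y} → x ≈ y → φ x ≈ φ y
  φ-cong = lift-cong +-abelianGroup (λ e → []-cong (R.^-congˡ p e))

  φ⁻¹-cong : ∀ {x y} → x ≈ y → φ⁻¹ x ≈ φ⁻¹ y
  φ⁻¹-cong = lift-cong +-abelianGroup (λ e → []-cong (frobenius⁻¹-cong e))

  π-cong : ∀ {x y} → x ≈ y → π x R.≈ π y
  π-cong = lift-cong R.+-abelianGroup (λ e → e)

  φ-* : ∀ x y → φ (x * y) ≈ φ x * φ y
  φ-* = lift-*-homo ℤR-commutativeRing (λ r s → []-cong (R.^-distrib-* r s p))

  φ⁻¹-* : ∀ x y → φ⁻¹ (x * y) ≈ φ⁻¹ x * φ⁻¹ y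
  φ⁻¹-* = lift-*-homo ℤR-commutativeRing (λ r s → []-cong (frobenius⁻¹-homo r s))

  π-* : ∀ x y → π (x * y) R.≈ π x R.* π y
  π-* = lift-*-homo R (λ _ _ → R.refl)

  φ-φ⁻¹ : ∀ x → φ (φ⁻¹ x) ≈ x
  φ-φ⁻¹ = lift-inverse frobenius-frobenius⁻¹

  φ⁻¹-φ : ∀ x → φ⁻¹ (φ x) ≈ x
  φ⁻¹-φ = lift-inverse (λ r → frobenius-injective (frobenius-frobenius⁻¹ (r R.^ p)))

  π-^ : ∀ x n → π (x ^ n) R.≈ π x R.^ n
  π-^ x zero    = R.refl
  π-^ x (suc n) = R.trans (π-* x (x ^ n)) (R.*-congˡ (π-^ x n))

  p×r≈0 : ∀ r → p R.× r R.≈ R.0#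
  p×r≈0 r = R.trans (R.×-congʳ p (R.sym (R.*-identityˡ r))) (R.trans (R.sym (R.×-assoc-* p R.1# r))
              (R.trans (R.*-congʳ p×1≈0) (R.zeroˡ r)))

  π-p× : ∀ x → π (p × x) R.≈ R.0#
  π-p× x = R.trans (R.reflexive (lift-× R.+-abelianGroup p x)) (p×r≈0 (π x))

  -- The difference `φ x - x ^ p` is `p × δ x`, which `π` kills because `R` has characteristic `p`.
  π-φ : ∀ x → π (φ x) R.≈ π x R.^ p
  π-φ x = R.trans (R.x∙y⁻¹≈ε⇒x≈y _ _ (R.trans (π-cong (sym (δ-spec x))) (π-p× (δ x)))) (π-^ x p)

  φ-I : ∀ {x} → I x → I (φ x)
  φ-I {x} hx = R.trans (π-φ x) (R.trans (R.^-congˡ p hx) (R.^-zero p))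

  -- The `p`-th power of `π (φ⁻¹ x)` is `π x`, and the Frobenius of `R` is injective.
  φ⁻¹-I : ∀ {x} → I x → I (φ⁻¹ x)
  φ⁻¹-I {x} hx = frobenius-injective
    (R.trans (R.sym (π-φ (φ⁻¹ x))) (R.trans (π-cong (φ-φ⁻¹ x)) (R.trans hx (R.sym (R.^-zero p)))))

  φ-power : ∀ n {x} → power I n x → power I n (φ x)
  φ-power = power-map φ refl (λ _ _ → refl) φ-* φ-cong (λ {x} → φ-I {x})

  φ⁻¹-power : ∀ n {x} → power I n x → power I n (φ⁻¹ x)
  φ⁻¹-power = power-map φ⁻¹ refl (λ _ _ → refl) φ⁻¹-* φ⁻¹-cong (λ {x} → φ⁻¹-I {x})

  -- The arithmetic derivation on powers of `I`, and division by `p`.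

  power⇒I : ∀ n {x} → power I (suc n) x → I x
  power⇒I n 0∈         = R.refl
  power⇒I n (+∈ g h)   = R.trans (R.+-cong (power⇒I n g) (power⇒I n h)) (R.+-identityˡ _)
  power⇒I n (*∈ {x} {y} hx hy) = R.trans (π-* x y) (R.trans (R.*-congʳ hx) (R.zeroˡ _))
  power⇒I n (resp e h) = R.trans (π-cong (sym e)) (power⇒I n h)

  -- By torsion-freeness d ≈ δ u.
  δ-power : ∀ n {u} → power I (suc n) u → ∃ λ d → power I n d ∧ (p × d ≈ φ u - u ^ p)
  δ-power zero    {u} _ = δ u , tt , δ-spec u
  -- `δ 0#` computes to `0#`.
  δ-power (suc n) 0∈ = 0# , 0∈ , δ-spec 0#
  δ-power (suc n) (+∈ {x} {y} g h) =
    let d  , hd  , eq  = δ-power (suc n) g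
        d′ , hd′ , eq′ = δ-power (suc n) h
        -- The correction to additivity of `δ` is a multiple of `x`, so it lies in every power of
        -- `I` that contains `x`.
        e , expand = freshman-ideal p-prime ℤR-commutativeRing x y
    in  (d + d′) - x * e
      , power-sub (suc n) (power-+ (suc n) hd hd′) (power-*ʳ (suc n) e (power-pred (suc n) g))
      , quotient-+ p eq eq′ expand
  δ-power (suc n) (*∈ {x} {y} hx hy) =
    let d , hd , eq = δ-power n hy
    -- Leibniz rule for `δ (x * y)`. The first summand loses only the factor `x`, since `φ`
    -- preserves powers of `I`; in the second, `x ^ p` in `I` makes up for the power lost from `y`
    -- to `d`.
    in  δ x * φ y + x ^ p * d
      , power-+ (suc n) (power-*ˡ (suc n) (δ x) (φ-power (suc n) hy))
                        (*∈ (power⇒I 0 (^-power {n = p} (ℕ.>-nonZero⁻¹ p) hx)) hd)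
      , trans (quotient-* p (δ-spec x) eq)
              (+-cong (sym (φ-* x y)) (-‿cong (sym (^-distrib-* x y p))))
  δ-power (suc n) (resp e h) =
    let d , hd , eq = δ-power (suc n) h
    in d , hd , trans eq (+-cong (φ-cong e) (-‿cong (^-congˡ p e)))

  φ-p× : ∀ x → φ (p × x) ≈ p × φ x
  φ-p× x = reflexive (lift-× +-abelianGroup p x)

  -- δ (p a) = φ a - p ^ (p - 1) a ^ p, and p ^ (p - 1) a ^ p is a multiple of p a.
  p×-power : ∀ n {a} → power I (suc n) (p × a) → power I n a
  p×-power n {a} h =
    let d , hd , eq = δ-power n h
    -- Adding `a * w` to `d` puts `φ a` in Iⁿ, and `φ⁻¹` carries this back to `a`.
    in power-resp n (φ⁻¹-φ a) (φ⁻¹-power n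
         (power-resp n (trans (+-congʳ (d≈ d eq)) (//-rightDividesˡ (a * w) (φ a)))
           (power-+ n hd (power-*ˡ n a (power-^ (ℕ.pred p) {{pred-p-nonZero}})))))
    where
    open import Relation.Binary.Reasoning.Setoid setoid
    w = (p × a) ^ ℕ.pred p
    -- As `p` is at least 2, `w` retains a factor `p × a` and hence lies in Iⁿ.
    pred-p-nonZero : ℕ.NonZero (ℕ.pred p)
    pred-p-nonZero = ℕ.>-nonZero (ℕ.pred-mono-≤ (ℕ.nonTrivial⇒n>1 p {{prime⇒nonTrivial p-prime}}))
    power-^ : ∀ k → .{{ℕ.NonZero k}} → power I n ((p × a) ^ k)
    power-^ (suc k) = power-*ʳ n _ (power-pred n h)
    d≈ : ∀ d → p × d ≈ φ (p × a) - (p × a) ^ p → d ≈ φ a - a * w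
    d≈ d eq = ×-cancelˡ p (begin
      p × d                               ≈⟨ eq ⟩
      φ (p × a) - (p × a) ^ p             ≈⟨ +-cong (φ-p× a) (-‿cong (^-congʳ (p × a) (≡.sym (ℕ.suc-pred p)))) ⟩
      p × φ a - (p × a) * w               ≈⟨ +-congˡ (-‿cong (×-assoc-* p a w)) ⟩
      p × φ a - p × (a * w)               ≈⟨ ×-distrib-sub p (φ a) (a * w) ⟨
      p × (φ a - a * w)                   ∎)

  -- Witt components and their recursion.

  φ⁻¹β : ∀ n → W n → ℤR
  φ⁻¹β n r = ∑[ k < n ] ((p ℕ.^ toℕ k) × [ iterate frobenius⁻¹ (r k) (suc (toℕ k)) ])

  -- `φ⁻¹β` is written out as a sum so that its summands carry the same iterates as the tail of
  -- `β (suc n) r`; only one factor `p` has to be moved out.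
  β-suc : ∀ n (r : W (suc n)) → β (suc n) r ≈ [ r zero ] + p × φ⁻¹β n (tail r)
  β-suc n r = +-cong (×-homo-1 [ r zero ])
    (trans (sum-cong-≋ {n} (λ k → sym (×-assocˡ (g k) p (p ℕ.^ toℕ k))))
           (sym (×-distrib-sum p {n} (λ k → (p ℕ.^ toℕ k) × g k))))
    where
    g : Vector ℤR n
    g k = [ iterate frobenius⁻¹ (r (suc k)) (suc (toℕ k)) ]

  φ-φ⁻¹β : ∀ n (r : W n) → φ (φ⁻¹β n r) ≈ β n r
  φ-φ⁻¹β n r = trans (reflexive (lift-sum +-abelianGroup {n = n} (λ k → (p ℕ.^ toℕ k) × g k)))
    (sum-cong-≋ {n} λ k →
      trans (reflexive (lift-× +-abelianGroup (p ℕ.^ toℕ k) (g k)))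
            (×-congʳ (p ℕ.^ toℕ k) ([]-cong (frobenius-iterate (r k) (toℕ k)))))
    where
    g : Vector ℤR n
    g k = [ iterate frobenius⁻¹ (r k) (suc (toℕ k)) ]
    -- `iterate` updates its starting value, so the induction moves `s` to `frobenius⁻¹ s` until
    -- only the outermost application is left.
    frobenius-iterate : ∀ s k → iterate frobenius⁻¹ s (suc k) R.^ p R.≈ iterate frobenius⁻¹ s k
    frobenius-iterate s zero    = frobenius-frobenius⁻¹ s
    frobenius-iterate s (suc k) = frobenius-iterate (frobenius⁻¹ s) k

  module _ n (x : ℤR) (r : W (suc n)) (α : α[ suc n ] x ↦ r) where

    private
      z = x - [ r zero ]
      b = φ⁻¹β n (tail r)

    remainder : power I (suc n) (z - p × b)
    remainder = power-resp (suc n) (trans (+-congˡ (-‿cong (β-suc n r))) (sym (sub-sub _ _ _))) α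

    -- `z` is the sum of `z - p × b`, which lies in a positive power of `I`, and `p × b`, which `π`
    -- kills.
    z∈I : I z
    z∈I = R.trans (π-cong (sym (//-rightDividesˡ (p × b) z)))
      (R.trans (R.+-cong (power⇒I n remainder) (π-p× b)) (R.+-identityˡ _))

    α-head : r zero R.≈ π x
    α-head = R.sym (R.x∙y⁻¹≈ε⇒x≈y _ _ z∈I)

    -- Multiplied by `p`, the difference becomes the image of `remainder` under `φ` minus `z ^ p`.
    -- The bound on `n` puts `z ^ p` in Iⁿ⁺¹, and `p×-power` removes the factor `p`.
    α-tail : suc n ≤ p → α[ n ] δ z ↦ tail r
    α-tail n<p = p×-power n (power-resp (suc n) (sym p×δ)
      (power-sub (suc n) (φ-power (suc n) remainder) (^-power n<p z∈I)))
      where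
      open import Relation.Binary.Reasoning.Setoid setoid
      p×δ : p × (δ z - β n (tail r)) ≈ φ (z - p × b) - z ^ p
      p×δ = begin
        p × (δ z - β n (tail r))           ≈⟨ ×-distrib-sub p _ _ ⟩
        p × δ z - p × β n (tail r)         ≈⟨ +-cong (δ-spec z) (-‿cong (×-congʳ p (sym (φ-φ⁻¹β n (tail r))))) ⟩
        (φ z - z ^ p) - p × φ b            ≈⟨ +-congˡ (-‿cong (φ-p× b)) ⟨
        (φ z - z ^ p) - φ (p × b)          ≈⟨ xy∙z≈xz∙y _ _ _ ⟩
        (φ z - φ (p × b)) - z ^ p          ∎

  -- `y` adds its newest step on the outside, whereas the induction on `n` strips the first
  -- component; this reconciles the two recursions.
  y-tail : ∀ {n} x (r : W (suc n)) ν (h : suc ν < suc n) (h′ : ν < n) →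
           y x r (suc ν) h ≡ y (δ (x - [ r zero ])) (tail r) ν h′
  y-tail x r zero    h h′ = ≡.refl
  y-tail x r (suc ν) h h′ =
    ≡.cong (λ u → δ (u - [ r (fromℕ< (ℕ.<⇒≤ h)) ])) (y-tail x r ν (ℕ.<⇒≤ h) (ℕ.<⇒≤ h′))

  -- Induction on `n` with `x` and `r` varying: component `suc ν` for `x` is component `ν` for
  -- `δ (x - [ r zero ])`.
  components : ∀ n → n ≤ p → ∀ (x : ℤR) (r : W n) → α[ n ] x ↦ r →
               ∀ ν (ν<n : ν < n) → r (fromℕ< ν<n) R.≈ π (y x r ν ν<n)
  components (suc n) n<p x r α zero    ν<n = α-head n x r α
  components (suc n) n<p x r α (suc ν) ν<n =
    ≡.subst (λ u → _ R.≈ π u) (≡.sym (y-tail x r ν ν<n (ℕ.s<s⁻¹ ν<n)))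
      (components n (ℕ.<⇒≤ n<p) _ (tail r) (α-tail n x r α n<p) ν (ℕ.s<s⁻¹ ν<n))

theorem3 : ∀ {c ℓ} (p : ℕ) (p-prime : Prime p)
    (R : CommutativeRing c ℓ) (perfect : IsPerfectFpAlgebra p R) →
    let open Perfect p p-prime R perfect
        open CommutativeRing R using (_≈_) in
    ∀ (n : ℕ) → 2 ≤ n → n ≤ p →
    ∀ (x : ℤR) (r : W n) → α[ n ] x ↦ r →
    ∀ (ν : ℕ) (ν<n : ν < n) → r (fromℕ< ν<n) ≈ π (y x r ν ν<n)
theorem3 p p-prime R perfect n _ n≤p = PerfectProperties.components p p-prime R perfect n n≤p
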